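{- For every integer $n$ greater than $5$, there is a metric space on $n$ points where each closure-line consists of at most $n-2$ points and there are precisely $7$ distinct closure-lines altogether.
   Context: A hypergraph is an ordered pair $(X,H)$ such that $X$ is a set (of vertices) and $H$ is a family of subsets of $X$ (edges). A set $T$ of vertices in a hypergraph is called affinely closed if, and only if, every edge that shares at least two vertices with $T$ is fully contained in $T$. For every set $S$ of vertices, the affine closure $\mathrm{aff}(S)$ is the intersection of all affinely closed supersets of $S$ (it is itself affinely closed). The closure-lines in the hypergraph are all the sets $\mathrm{aff}(\{u,v\})$ with $u$ and $v$ two distinct vertices. For a metric space $(X,\rho)$, write $[abc]$ to mean that $a,b,c$ are three distinct points of $X$ and $\rho(a,b)+\rho(b,c)=\rho(a,c)$. The hypergraph associated with $(X,\rho)$ is $(X,H(\rho))$ with $H(\rho)=\{\{a,b,c\}:\,[abc]\}$. The closure-lines in the metric space $(X,\rho)$ are the closure-lines in the hypergraph $(X,H(\rho))$. -}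

module Defs where

open import Algebra.Bundles using (module CommutativeMonoid)
open import Data.Fin using (Fin)
open import Data.Fin.Subset as Subset using (Subset)
open import Data.Nat as ℕ using (ℕ)
import Data.Nat.Properties as ℕ
open import Data.Product using (Σ-syntax; ∃₂; ∃-syntax; _×_; _,_)
open import Data.Rational as ℚ using (ℚ; 0ℚ; ½; Positive)
import Data.Rational.Properties as ℚ
open import Function.Metric using (IsGeneralMetric)
open import Level using (Level; 0ℓ; suc)
open import Relation.Binary using (Rel)
open import Relation.Binary.PropositionalEquality
  using (_≡_; _≢_; cong; subst; sym; trans)
open import Relation.Unary using (Pred; _∈_; _⊆_; _≐_; _∩_; _∪_; ｛_｝)

open import Algebra.Properties.CommutativeSemigroup
  (CommutativeMonoid.commutativeSemigroup ℚ.+-0-commutativeMonoid)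
  using () renaming (interchange to +-interchange)

-- The real numbers, as Cauchy sequences of rationals.  Equality of reals is
-- _≃_ (the difference is a null sequence), not propositional equality.

IsCauchy : (ℕ → ℚ) → Set
IsCauchy x = ∀ ε → Positive ε →
  ∃[ N ] ∀ m n → m ℕ.≥ N → n ℕ.≥ N → ℚ.∣ x m ℚ.- x n ∣ ℚ.≤ ε

record ℝ : Set where
  constructor mkℝ
  field
    seq    : ℕ → ℚ
    cauchy : IsCauchy seq

open ℝ public

infix  4 _≃_ _≤_
infixl 6 _+_

_≃_ : Rel ℝ 0ℓ
x ≃ y = ∀ ε → Positive ε →
  ∃[ N ] ∀ n → n ℕ.≥ N → ℚ.∣ seq x n ℚ.- seq y n ∣ ℚ.≤ ε

_≤_ : Rel ℝ 0ℓ
x ≤ y = ∀ ε → Positive ε →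
  ∃[ N ] ∀ n → n ℕ.≥ N → seq x n ℚ.≤ seq y n ℚ.+ ε

fromℚ : ℚ → ℝ
fromℚ q = mkℝ (λ _ → q) λ ε ε>0 → 0 , λ _ _ _ _ →
  subst (λ d → ℚ.∣ d ∣ ℚ.≤ ε) (sym (ℚ.+-inverseʳ q))
    (ℚ.<⇒≤ (ℚ.positive⁻¹ ε {{ε>0}}))

0ℝ : ℝ
0ℝ = fromℚ 0ℚ

_+_ : ℝ → ℝ → ℝ
x + y = mkℝ (λ n → seq x n ℚ.+ seq y n) λ ε ε>0 →
  let instance
        _ = ε>0
      (M , p) = cauchy x (½ ℚ.* ε) (ℚ.pos*pos⇒pos ½ ε)
      (N , q) = cauchy y (½ ℚ.* ε) (ℚ.pos*pos⇒pos ½ ε)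
  in M ℕ.⊔ N , λ m n m≥ n≥ → begin
    ℚ.∣ (seq x m ℚ.+ seq y m) ℚ.- (seq x n ℚ.+ seq y n) ∣
      ≡⟨ cong ℚ.∣_∣ (interchange (seq x m) (seq y m) (seq x n) (seq y n)) ⟩
    ℚ.∣ (seq x m ℚ.- seq x n) ℚ.+ (seq y m ℚ.- seq y n) ∣
      ≤⟨ ℚ.∣p+q∣≤∣p∣+∣q∣ (seq x m ℚ.- seq x n) (seq y m ℚ.- seq y n) ⟩
    ℚ.∣ seq x m ℚ.- seq x n ∣ ℚ.+ ℚ.∣ seq y m ℚ.- seq y n ∣
      ≤⟨ ℚ.+-mono-≤ (p m n (ℕ.m⊔n≤o⇒m≤o M N m≥) (ℕ.m⊔n≤o⇒m≤o M N n≥))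
                    (q m n (ℕ.m⊔n≤o⇒n≤o M N m≥) (ℕ.m⊔n≤o⇒n≤o M N n≥)) ⟩
    ½ ℚ.* ε ℚ.+ ½ ℚ.* ε
      ≡⟨ halves ε ⟩
    ε ∎
  where
  open ℚ.≤-Reasoning

  interchange : ∀ a b c d →
    (a ℚ.+ b) ℚ.- (c ℚ.+ d) ≡ (a ℚ.- c) ℚ.+ (b ℚ.- d)
  interchange a b c d = trans
    (cong (a ℚ.+ b ℚ.+_) (ℚ.neg-distrib-+ c d))
    (+-interchange a b (ℚ.- c) (ℚ.- d))

  halves : ∀ ε → ½ ℚ.* ε ℚ.+ ½ ℚ.* ε ≡ ε
  halves ε = trans (sym (ℚ.*-distribʳ-+ ε ½ ½)) (ℚ.*-identityˡ ε)

record MetricSpace (X : Set) : Set where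
  field
    ρ        : X → X → ℝ
    isMetric : IsGeneralMetric _≡_ _≃_ _≤_ 0ℝ _+_ ρ

-- A hypergraph with vertex set X is its family of edges; sets of vertices
-- are compared by _≐_.

Hypergraph : Set → Set₁
Hypergraph X = Pred (Pred X 0ℓ) 0ℓ

module _ {X : Set} (H : Hypergraph X) where

  AffinelyClosed : Pred X 0ℓ → Set₁
  AffinelyClosed T = ∀ {E} → E ∈ H →
    ∀ {u v} → u ≢ v → u ∈ E ∩ T → v ∈ E ∩ T → E ⊆ T

  -- An intersection over all closed T, hence one universe level above T.
  aff : Pred X 0ℓ → Pred X (suc 0ℓ)
  aff S x = ∀ T → AffinelyClosed T → S ⊆ T → x ∈ T

  IsClosureLine : Pred (Pred X (suc 0ℓ)) (suc 0ℓ)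
  IsClosureLine L = ∃₂ λ u v → u ≢ v × L ≐ aff (｛ u ｝ ∪ ｛ v ｝)

module _ {X : Set} (M : MetricSpace X) where
  open MetricSpace M

  Between : X → X → X → Set
  Between a b c = a ≢ b × b ≢ c × a ≢ c × ρ a b + ρ b c ≃ ρ a c

  hypergraph : Hypergraph X
  hypergraph E =
    ∃[ a ] ∃[ b ] ∃[ c ] Between a b c × E ≐ ｛ a ｝ ∪ ｛ b ｝ ∪ ｛ c ｝

private variable
  ℓ ℓ′ : Level

HasAtMost : ∀ {n} → ℕ → Pred (Fin n) ℓ → Set ℓ
HasAtMost {n = n} k P =
  Σ[ S ∈ Subset n ] P ≐ (Subset._∈ S) × Subset.∣ S ∣ ℕ.≤ k

-- Members of the family 𝓛 are counted up to extensional equality _≐_.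

HasExactly : {X : Set} → ℕ → Pred (Pred X ℓ) ℓ′ → Set _
HasExactly {ℓ = ℓ} {X = X} k 𝓛 = Σ[ line ∈ (Fin k → Pred X ℓ) ]
    (∀ i → line i ∈ 𝓛)
  × (∀ i j → line i ≐ line j → i ≡ j)
  × (∀ L → L ∈ 𝓛 → ∃[ i ] L ≐ line i)

{-# OPTIONS --safe #-}

-- Let A = {a₀, …, aₘ₋₁} be m = n − 4 points of a real line, at unit distances,
-- and add four corners w, x, y, z with
--   ρ(aᵢ,w) = ρ(aᵢ,y) = m,  ρ(aᵢ,x) = ρ(aᵢ,z) = m + 1,
--   ρ(w,x) = ρ(y,z) = 1,  and all other distances between corners equal to 2.
-- The only collinear triples are those inside A, {aᵢ,w,x} and {aᵢ,y,z}: each aᵢ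
-- sees x exactly behind w and z exactly behind y.  Hence the closure-lines are
-- A, A ∪ {w,x}, A ∪ {y,z} and the four pairs {w,y}, {w,z}, {x,y}, {x,z}.

module Submission where

open import Defs
open import Data.Bool as Bool using (Bool)
open import Data.Fin using (#_; Fin; zero; suc; toℕ; splitAt; join)
open import Data.Fin.Properties as Fin using (_≟_; all?; toℕ<n; toℕ-injective)
open import Data.Fin.Subset as Subset using (Subset; inside; outside)
import Data.Fin.Subset.Properties as Subset
open import Data.Integer as ℤ using (+_)
import Data.Integer.Properties as ℤ
open import Data.Nat as ℕ using (ℕ; suc; ∣_-_∣; _>_; _∸_)
import Data.Nat.Properties as ℕ
open import Data.Product using (Σ-syntax; _×_; _,_; proj₁; proj₂)
open import Data.Rational as ℚ using (ℚ; ½; *≤*)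
open import Data.Rational.Literals using (fromℤ)
import Data.Rational.Properties as ℚ
open import Data.Sum using (_⊎_; inj₁; inj₂; [_,_]′)
open import Data.Sum.Properties using (inj₁-injective; inj₂-injective)
open import Data.Vec using (Vec; []; _∷_; lookup; replicate; _++_)
import Data.Vec.Properties as Vec
open import Function using (_∘_; const)
open import Level using (0ℓ)
open import Relation.Binary using (IsPartialOrder)
open import Relation.Binary.PropositionalEquality
open import Relation.Nullary
  using (¬_; Dec; yes; no; ¬?; contradiction; _×-dec_; _⊎-dec_; _→-dec_)
open import Relation.Nullary.Decidable using (from-yes)
open import Relation.Unary using (Pred; _≐_; _∪_; ｛_｝; _∈_; _⊆_)
open import Relation.Unary.Properties using (≐-sym; ≐-trans)

open import Algebra.Properties.AbelianGroup ℚ.+-0-abelianGroup using (xyx⁻¹≈y)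
open import Algebra.Properties.CommutativeSemigroup ℕ.+-commutativeSemigroup
  using (x∙yz≈y∙xz)
open import Algebra.Properties.Group ℚ.+-0-group using (⁻¹-anti-homo-//)

-- Real numbers

p≤∣p∣ : ∀ p → p ℚ.≤ ℚ.∣ p ∣
p≤∣p∣ p with ℚ.≤-total ℚ.0ℚ p
... | inj₁ 0≤p = ℚ.≤-reflexive (sym (ℚ.0≤p⇒∣p∣≡p 0≤p))
... | inj₂ p≤0 = ℚ.≤-trans p≤0 (ℚ.0≤∣p∣ p)

q+[p-q]≡p : ∀ p q → q ℚ.+ (p ℚ.- q) ≡ p
q+[p-q]≡p p q = trans (sym (ℚ.+-assoc q p (ℚ.- q))) (xyx⁻¹≈y q p)

∣p-q∣≡∣q-p∣ : ∀ p q → ℚ.∣ p ℚ.- q ∣ ≡ ℚ.∣ q ℚ.- p ∣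
∣p-q∣≡∣q-p∣ p q = trans (sym (ℚ.∣-p∣≡∣p∣ (p ℚ.- q))) (cong ℚ.∣_∣ (⁻¹-anti-homo-// p q))

p≤q+r⇒p-q≤r : ∀ {p q r} → p ℚ.≤ q ℚ.+ r → p ℚ.- q ℚ.≤ r
p≤q+r⇒p-q≤r {p} {q} {r} p≤q+r = begin
  p ℚ.- q         ≤⟨ ℚ.+-monoˡ-≤ (ℚ.- q) p≤q+r ⟩
  q ℚ.+ r ℚ.- q   ≡⟨ xyx⁻¹≈y q r ⟩
  r               ∎
  where open ℚ.≤-Reasoning

∣p-q∣≤r⇒p≤q+r : ∀ {p q r} → ℚ.∣ p ℚ.- q ∣ ℚ.≤ r → p ℚ.≤ q ℚ.+ r
∣p-q∣≤r⇒p≤q+r {p} {q} {r} ∣p-q∣≤r = begin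
  p                ≡⟨ q+[p-q]≡p p q ⟨
  q ℚ.+ (p ℚ.- q)  ≤⟨ ℚ.+-monoʳ-≤ q (ℚ.≤-trans (p≤∣p∣ (p ℚ.- q)) ∣p-q∣≤r) ⟩
  q ℚ.+ r          ∎
  where open ℚ.≤-Reasoning

p≤q+r×q≤p+r⇒∣p-q∣≤r : ∀ {p q r} → p ℚ.≤ q ℚ.+ r → q ℚ.≤ p ℚ.+ r →
  ℚ.∣ p ℚ.- q ∣ ℚ.≤ r
p≤q+r×q≤p+r⇒∣p-q∣≤r {p} {q} {r} p≤q+r q≤p+r
  with ℚ.∣p∣≡p∨∣p∣≡-p (p ℚ.- q)
... | inj₁ eq = subst (ℚ._≤ r) (sym eq) (p≤q+r⇒p-q≤r p≤q+r)
... | inj₂ eq = subst (ℚ._≤ r)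
  (trans (sym (⁻¹-anti-homo-// p q)) (sym eq))
  (p≤q+r⇒p-q≤r q≤p+r)

≤-refl : ∀ {x} → x ≤ x
≤-refl {x} ε ε>0 = 0 , λ n _ → begin
  seq x n            ≡⟨ ℚ.+-identityʳ (seq x n) ⟨
  seq x n ℚ.+ ℚ.0ℚ   ≤⟨ ℚ.+-monoʳ-≤ (seq x n) (ℚ.<⇒≤ (ℚ.positive⁻¹ ε {{ε>0}})) ⟩
  seq x n ℚ.+ ε      ∎
  where open ℚ.≤-Reasoning

½ε+½ε≡ε : ∀ ε → ½ ℚ.* ε ℚ.+ ½ ℚ.* ε ≡ ε
½ε+½ε≡ε ε = trans (sym (ℚ.*-distribʳ-+ ε ½ ½)) (ℚ.*-identityˡ ε)

≤-trans : ∀ {x y z} → x ≤ y → y ≤ z → x ≤ z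
≤-trans {x} {y} {z} x≤y y≤z ε ε>0 =
  let instance _ = ε>0
      (M , p) = x≤y (½ ℚ.* ε) (ℚ.pos*pos⇒pos ½ ε)
      (N , q) = y≤z (½ ℚ.* ε) (ℚ.pos*pos⇒pos ½ ε)
  in M ℕ.⊔ N , λ n n≥ → begin
    seq x n
      ≤⟨ p n (ℕ.m⊔n≤o⇒m≤o M N n≥) ⟩
    seq y n ℚ.+ ½ ℚ.* ε
      ≤⟨ ℚ.+-monoˡ-≤ (½ ℚ.* ε) (q n (ℕ.m⊔n≤o⇒n≤o M N n≥)) ⟩
    seq z n ℚ.+ ½ ℚ.* ε ℚ.+ ½ ℚ.* ε
      ≡⟨ ℚ.+-assoc (seq z n) (½ ℚ.* ε) (½ ℚ.* ε) ⟩
    seq z n ℚ.+ (½ ℚ.* ε ℚ.+ ½ ℚ.* ε)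
      ≡⟨ cong (seq z n ℚ.+_) (½ε+½ε≡ε ε) ⟩
    seq z n ℚ.+ ε ∎
  where open ℚ.≤-Reasoning

≤-antisym : ∀ {x y} → x ≤ y → y ≤ x → x ≃ y
≤-antisym x≤y y≤x ε ε>0 =
  let (M , p) = x≤y ε ε>0
      (N , q) = y≤x ε ε>0
  in M ℕ.⊔ N , λ n n≥ → p≤q+r×q≤p+r⇒∣p-q∣≤r
    (p n (ℕ.m⊔n≤o⇒m≤o M N n≥)) (q n (ℕ.m⊔n≤o⇒n≤o M N n≥))

≃⇒≤ : ∀ {x y} → x ≃ y → x ≤ y
≃⇒≤ x≃y ε ε>0 = let (N , p) = x≃y ε ε>0 in N , λ n n≥ → ∣p-q∣≤r⇒p≤q+r (p n n≥)

≃-sym : ∀ {x y} → x ≃ y → y ≃ x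
≃-sym {x} {y} x≃y ε ε>0 = let (N , p) = x≃y ε ε>0 in
  N , λ n n≥ → subst (ℚ._≤ ε) (∣p-q∣≡∣q-p∣ (seq x n) (seq y n)) (p n n≥)

≤-isPartialOrder : IsPartialOrder _≃_ _≤_
≤-isPartialOrder = record
  { isPreorder = record
    { isEquivalence = record
      { refl  = λ {x} → ≤-antisym {x} {x} (≤-refl {x}) (≤-refl {x})
      ; sym   = λ {x} {y} → ≃-sym {x} {y}
      -- Transitivity of `_≃_` follows from two uses of `≤-trans`, so the splitting of ε into halves
      -- is done only once.
      ; trans = λ {x} {y} {z} x≃y y≃z → ≤-antisym {x} {z}
          (≤-trans {x} {y} {z} (≃⇒≤ {x} {y} x≃y) (≃⇒≤ {y} {z} y≃z))
          (≤-trans {z} {y} {x} (≃⇒≤ {z} {y} (≃-sym {y} {z} y≃z))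
                               (≃⇒≤ {y} {x} (≃-sym {x} {y} x≃y)))
      }
    ; reflexive = λ {x} {y} → ≃⇒≤ {x} {y}
    ; trans     = λ {x} {y} {z} → ≤-trans {x} {y} {z}
    }
  ; antisym = λ {x} {y} → ≤-antisym {x} {y}
  }

fromℚ-mono-≤ : ∀ {p q} → p ℚ.≤ q → fromℚ p ≤ fromℚ q
fromℚ-mono-≤ {p} {q} p≤q ε ε>0 = 0 , λ _ _ → begin
  p            ≤⟨ p≤q ⟩
  q            ≡⟨ ℚ.+-identityʳ q ⟨
  q ℚ.+ ℚ.0ℚ   ≤⟨ ℚ.+-monoʳ-≤ q (ℚ.<⇒≤ (ℚ.positive⁻¹ ε {{ε>0}})) ⟩
  q ℚ.+ ε      ∎
  where open ℚ.≤-Reasoning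

fromℚ-cancel-≤ : ∀ {p q} → fromℚ p ≤ fromℚ q → p ℚ.≤ q
fromℚ-cancel-≤ {p} {q} p≤q with p ℚ.≤? q
... | yes p≤q′ = p≤q′
... | no p≰q =
  -- If q < p, pick r strictly between them. The tolerance ε = r - q then gives p ≤ q + (r - q) = r,
  -- a contradiction.
  let (r , q<r , r<p) = ℚ.<-dense (ℚ.≰⇒> p≰q)
      (N , bound)     = p≤q (r ℚ.- q) (ℚ.positive
        (subst (ℚ._< r ℚ.- q) (ℚ.+-inverseʳ q) (ℚ.+-monoˡ-< (ℚ.- q) q<r)))
  in contradiction
    (subst (p ℚ.≤_) (q+[p-q]≡p r q) (bound N ℕ.≤-refl))
    λ p≤r → ℚ.<-irrefl refl (ℚ.<-≤-trans r<p p≤r)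

fromℚ-cong : ∀ {p q} → p ≡ q → fromℚ p ≃ fromℚ q
fromℚ-cong {p} refl = ≤-antisym {fromℚ p} {fromℚ p} (≤-refl {fromℚ p}) (≤-refl {fromℚ p})

fromℚ-injective : ∀ {p q} → fromℚ p ≃ fromℚ q → p ≡ q
fromℚ-injective {p} {q} p≃q = ℚ.≤-antisym
  (fromℚ-cancel-≤ (≃⇒≤ {fromℚ p} {fromℚ q} p≃q))
  (fromℚ-cancel-≤ (≃⇒≤ {fromℚ q} {fromℚ p} (≃-sym {fromℚ p} {fromℚ q} p≃q)))

-- Natural numbers inside the rationals

fromℕ : ℕ → ℚ
fromℕ n = fromℤ (+ n)

fromℕ-mono-≤ : ∀ {m n} → m ℕ.≤ n → fromℕ m ℚ.≤ fromℕ n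
fromℕ-mono-≤ m≤n = *≤* (ℤ.*-monoʳ-≤-nonNeg (+ 1) (ℤ.+≤+ m≤n))

fromℕ-injective : ∀ {m n} → fromℕ m ≡ fromℕ n → m ≡ n
fromℕ-injective eq = ℤ.+-injective (cong ℚ.numerator eq)

-- Rational addition renormalises the quotient `(m * 1 + n * 1) / 1`. Once the left side is also
-- written as a quotient by 1, only the numerators have to agree.
fromℕ-+ : ∀ m n → fromℕ (m ℕ.+ n) ≡ fromℕ m ℚ.+ fromℕ n
fromℕ-+ m n = trans (sym (ℚ.fromℚᵘ-toℚᵘ (fromℕ (m ℕ.+ n))))
  (cong (ℚ._/ 1) (sym (cong₂ ℤ._+_ (ℤ.*-identityʳ (+ m)) (ℤ.*-identityʳ (+ n)))))

-- Closure in the hypergraph of a metric space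

-- What affine closedness demands of a single three-point edge. The condition is symmetric in the
-- three points, so the order of a collinear triple does not affect it.
Majority : ∀ {ℓ} → Set ℓ → Set ℓ → Set ℓ → Set ℓ
Majority P Q R = (P → Q → R) × (Q → R → P) × (P → R → Q)

module _ {X : Set} (M : MetricSpace X) where

  majority⇒closed : ∀ {T : Pred X 0ℓ} →
    (∀ {a b c} → Between M a b c → Majority (T a) (T b) (T c)) →
    AffinelyClosed (hypergraph M) T
  majority⇒closed {T} maj (a , b , c , [abc] , E⊆ , _) {u} {v} u≢v (u∈E , u∈T) (v∈E , v∈T) =
    from (all (E⊆ u∈E) (E⊆ v∈E)) ∘ E⊆
    where
    m₁ : T a → T b → T c
    m₁ = proj₁ (maj [abc])
    m₂ : T b → T c → T a
    m₂ = proj₁ (proj₂ (maj [abc]))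
    m₃ : T a → T c → T b
    m₃ = proj₂ (proj₂ (maj [abc]))

    all : u ∈ ｛ a ｝ ∪ ｛ b ｝ ∪ ｛ c ｝ → v ∈ ｛ a ｝ ∪ ｛ b ｝ ∪ ｛ c ｝ → T a × T b × T c
    all (inj₁ refl)        (inj₁ refl)        = contradiction refl u≢v
    all (inj₁ refl)        (inj₂ (inj₁ refl)) = u∈T , v∈T , m₁ u∈T v∈T
    all (inj₁ refl)        (inj₂ (inj₂ refl)) = u∈T , m₃ u∈T v∈T , v∈T
    all (inj₂ (inj₁ refl)) (inj₁ refl)        = v∈T , u∈T , m₁ v∈T u∈T
    all (inj₂ (inj₁ refl)) (inj₂ (inj₁ refl)) = contradiction refl u≢v
    all (inj₂ (inj₁ refl)) (inj₂ (inj₂ refl)) = m₂ u∈T v∈T , u∈T , v∈T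
    all (inj₂ (inj₂ refl)) (inj₁ refl)        = v∈T , m₃ v∈T u∈T , u∈T
    all (inj₂ (inj₂ refl)) (inj₂ (inj₁ refl)) = m₂ v∈T u∈T , v∈T , u∈T
    all (inj₂ (inj₂ refl)) (inj₂ (inj₂ refl)) = contradiction refl u≢v

    from : T a × T b × T c → ∀ {x} → x ∈ ｛ a ｝ ∪ ｛ b ｝ ∪ ｛ c ｝ → T x
    from (a∈T , _ , _) (inj₁ refl)        = a∈T
    from (_ , b∈T , _) (inj₂ (inj₁ refl)) = b∈T
    from (_ , _ , c∈T) (inj₂ (inj₂ refl)) = c∈T

  closed⇒majority : ∀ {T : Pred X 0ℓ} → AffinelyClosed (hypergraph M) T →
    ∀ {a b c} → Between M a b c → Majority (T a) (T b) (T c)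
  closed⇒majority closed {a} {b} {c} [abc]@(a≢b , b≢c , a≢c , _) =
      (λ a∈T b∈T → closed E a≢b (a∈ , a∈T) (b∈ , b∈T) c∈)
    , (λ b∈T c∈T → closed E b≢c (b∈ , b∈T) (c∈ , c∈T) a∈)
    , (λ a∈T c∈T → closed E a≢c (a∈ , a∈T) (c∈ , c∈T) b∈)
    where
    triple : Pred X 0ℓ
    triple = ｛ a ｝ ∪ ｛ b ｝ ∪ ｛ c ｝
    E : hypergraph M triple
    E = a , b , c , [abc] , (λ x∈ → x∈) , (λ x∈ → x∈)
    a∈ : a ∈ triple
    a∈ = inj₁ refl
    b∈ : b ∈ triple
    b∈ = inj₂ (inj₁ refl)
    c∈ : c ∈ triple
    c∈ = inj₂ (inj₂ refl)

-- Distances among the four corners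

Corner : Set
Corner = Fin 4

pattern w = zero
pattern x = suc zero
pattern y = suc (suc zero)
pattern z = suc (suc (suc zero))

mate : Corner → Corner
mate w = x
mate x = w
mate y = z
mate z = y

-- The excess over m of the distance from a corner to any axis point.
height : Corner → ℕ
height w = 0
height x = 1
height y = 0
height z = 1

gap : Corner → Corner → ℕ
gap c c′ with c ≟ c′ | c′ ≟ mate c
... | yes _ | _     = 0
... | no _  | yes _ = 1
... | no _  | no _  = 2

gap-refl : ∀ c → gap c c ≡ 0
gap-refl = from-yes (all? λ c → gap c c ℕ.≟ 0)

gap≡0⇒≡ : ∀ c c′ → gap c c′ ≡ 0 → c ≡ c′
gap≡0⇒≡ = from-yes (all? λ c → all? λ c′ → (gap c c′ ℕ.≟ 0) →-dec (c ≟ c′))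

gap-sym : ∀ c c′ → gap c c′ ≡ gap c′ c
gap-sym = from-yes (all? λ c → all? λ c′ → gap c c′ ℕ.≟ gap c′ c)

gap≤2 : ∀ c c′ → gap c c′ ℕ.≤ 2
gap≤2 = from-yes (all? λ c → all? λ c′ → gap c c′ ℕ.≤? 2)

gap-triangle : ∀ c c′ c″ → gap c c″ ℕ.≤ gap c c′ ℕ.+ gap c′ c″
gap-triangle = from-yes (all? λ c → all? λ c′ → all? λ c″ →
  gap c c″ ℕ.≤? gap c c′ ℕ.+ gap c′ c″)

-- Two gaps of 1 lead from a corner to its mate and back, and any other two nonzero gaps sum to at
-- least 3. Hence no three corners are collinear.
gap-triangle-strict : ∀ c c′ c″ → c ≢ c′ → c′ ≢ c″ →
  gap c c″ ℕ.< gap c c′ ℕ.+ gap c′ c″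
gap-triangle-strict = from-yes (all? λ c → all? λ c′ → all? λ c″ →
  ¬? (c ≟ c′) →-dec ¬? (c′ ≟ c″) →-dec gap c c″ ℕ.<? gap c c′ ℕ.+ gap c′ c″)

height-triangle : ∀ c c′ → height c ℕ.≤ gap c c′ ℕ.+ height c′
height-triangle = from-yes (all? λ c → all? λ c′ → height c ℕ.≤? gap c c′ ℕ.+ height c′)

-- Heights are at most 1, so equality forces a gap of 1, which only mates have.
height-tight : ∀ c c′ → c ≢ c′ → gap c c′ ℕ.+ height c′ ≡ height c → c′ ≡ mate c
height-tight = from-yes (all? λ c → all? λ c′ →
  ¬? (c ≟ c′) →-dec (gap c c′ ℕ.+ height c′ ℕ.≟ height c) →-dec c′ ≟ mate c)

-- Mates have gap 1 and heights 0 and 1. The alternatives say which of the two is farther from the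
-- axis.
mate-tight : ∀ c → gap c (mate c) ℕ.+ height (mate c) ≡ height c ⊎
                   gap (mate c) c ℕ.+ height c ≡ height (mate c)
mate-tight = from-yes (all? λ c →
  (gap c (mate c) ℕ.+ height (mate c) ℕ.≟ height c) ⊎-dec
  (gap (mate c) c ℕ.+ height c ℕ.≟ height (mate c)))

c≢mate : ∀ c → c ≢ mate c
c≢mate = from-yes (all? λ c → ¬? (c ≟ mate c))

-- Betweenness on the natural line

∣-∣-additive : ∀ {i j k} → i ℕ.≤ j → j ℕ.≤ k → ∣ i - j ∣ ℕ.+ ∣ j - k ∣ ≡ ∣ i - k ∣
∣-∣-additive {j = j} ℕ.z≤n j≤k =
  trans (cong (j ℕ.+_) (ℕ.m≤n⇒∣m-n∣≡n∸m j≤k)) (ℕ.m+[n∸m]≡n j≤k)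
∣-∣-additive (ℕ.s≤s i≤j) (ℕ.s≤s j≤k) = ∣-∣-additive i≤j j≤k

∣-∣-additive′ : ∀ {i j k} → k ℕ.≤ j → j ℕ.≤ i → ∣ i - j ∣ ℕ.+ ∣ j - k ∣ ≡ ∣ i - k ∣
∣-∣-additive′ {i} {j} {k} k≤j j≤i = begin
  ∣ i - j ∣ ℕ.+ ∣ j - k ∣ ≡⟨ cong₂ ℕ._+_ (ℕ.∣-∣-comm i j) (ℕ.∣-∣-comm j k) ⟩
  ∣ j - i ∣ ℕ.+ ∣ k - j ∣ ≡⟨ ℕ.+-comm ∣ j - i ∣ ∣ k - j ∣ ⟩
  ∣ k - j ∣ ℕ.+ ∣ j - i ∣ ≡⟨ ∣-∣-additive k≤j j≤i ⟩
  ∣ k - i ∣               ≡⟨ ℕ.∣-∣-comm k i ⟩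
  ∣ i - k ∣               ∎
  where open ≡-Reasoning

∣-∣-collinear : ∀ i j k →
  (∣ i - j ∣ ℕ.+ ∣ j - k ∣ ≡ ∣ i - k ∣) ⊎
  (∣ j - i ∣ ℕ.+ ∣ i - k ∣ ≡ ∣ j - k ∣) ⊎
  (∣ i - k ∣ ℕ.+ ∣ k - j ∣ ≡ ∣ i - j ∣)
∣-∣-collinear i j k with ℕ.≤-total i j | ℕ.≤-total j k | ℕ.≤-total i k
-- If the first two comparisons point the same way, j is in the middle. Otherwise j is extreme, and
-- comparing i with k finds the middle point.
... | inj₁ i≤j | inj₁ j≤k | _        = inj₁ (∣-∣-additive i≤j j≤k)
... | inj₂ j≤i | inj₂ k≤j | _        = inj₁ (∣-∣-additive′ k≤j j≤i)
... | inj₂ j≤i | inj₁ _   | inj₁ i≤k = inj₂ (inj₁ (∣-∣-additive j≤i i≤k))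
... | inj₁ i≤j | inj₂ _   | inj₂ k≤i = inj₂ (inj₁ (∣-∣-additive′ k≤i i≤j))
... | inj₁ _   | inj₂ k≤j | inj₁ i≤k = inj₂ (inj₂ (∣-∣-additive i≤k k≤j))
... | inj₂ _   | inj₁ j≤k | inj₂ k≤i = inj₂ (inj₂ (∣-∣-additive′ j≤k k≤i))

-- The metric space

Point : ℕ → Set
Point m = Corner ⊎ Fin m

inj₂-≢ : ∀ {m} {i j : Fin m} → i ≢ j → _≢_ {A = Point m} (inj₂ i) (inj₂ j)
inj₂-≢ i≢j = i≢j ∘ inj₂-injective

dist : ∀ {m} → Point m → Point m → ℕ
dist     (inj₁ c) (inj₁ c′) = gap c c′
dist {m} (inj₁ c) (inj₂ i)  = m ℕ.+ height c
dist {m} (inj₂ i) (inj₁ c)  = m ℕ.+ height c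
dist     (inj₂ i) (inj₂ j)  = ∣ toℕ i - toℕ j ∣

dist-refl : ∀ {m} (p : Point m) → dist p p ≡ 0
dist-refl (inj₁ c) = gap-refl c
dist-refl (inj₂ i) = ℕ.∣n-n∣≡0 (toℕ i)

dist-sym : ∀ {m} (p q : Point m) → dist p q ≡ dist q p
dist-sym (inj₁ c) (inj₁ c′) = gap-sym c c′
dist-sym (inj₁ c) (inj₂ i)  = refl
dist-sym (inj₂ i) (inj₁ c)  = refl
dist-sym (inj₂ i) (inj₂ j)  = ℕ.∣-∣-comm (toℕ i) (toℕ j)

dist≡0⇒≡ : ∀ {m} (p q : Point (suc m)) → dist p q ≡ 0 → p ≡ q
dist≡0⇒≡ (inj₁ c) (inj₁ c′) eq = cong inj₁ (gap≡0⇒≡ c c′ eq)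
-- The axis has `suc m` points, so this distance is a successor.
dist≡0⇒≡ (inj₁ c) (inj₂ i)  ()
dist≡0⇒≡ (inj₂ i) (inj₁ c)  ()
dist≡0⇒≡ (inj₂ i) (inj₂ j)  eq = cong inj₂ (toℕ-injective (ℕ.∣m-n∣≡0⇒m≡n eq))

∣toℕ-toℕ∣<n : ∀ {n} (i j : Fin n) → ∣ toℕ i - toℕ j ∣ ℕ.< n
∣toℕ-toℕ∣<n i j = ℕ.≤-<-trans (ℕ.∣m-n∣≤m⊔n (toℕ i) (toℕ j)) (ℕ.⊔-lub (toℕ<n i) (toℕ<n j))

-- Classification of collinear triples

-- Deliberately loose about order: `axis` does not ask that j be in the middle, nor `wing` that
-- `mate c` be nearer to the axis than c. The symmetry of `Majority` makes this harmless.
data Flat {m} : Point m → Point m → Point m → Set where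
  axis  : ∀ i j k → Flat (inj₂ i) (inj₂ j) (inj₂ k)
  wing  : ∀ c i → Flat (inj₁ c) (inj₁ (mate c)) (inj₂ i)
  wing′ : ∀ c i → Flat (inj₂ i) (inj₁ (mate c)) (inj₁ c)

module _ {k : ℕ} where

  private
    -- With a single axis point, corners at distance 2 such as w and y would be collinear with it;
    -- two axis points also serve to span the axis.
    m = 2 ℕ.+ k

  Tight : Point m → Point m → Point m → Set
  Tight p q r = p ≢ q × q ≢ r × p ≢ r × dist p q ℕ.+ dist q r ≡ dist p r

  Tight-sym : ∀ {p q r} → Tight p q r → Tight r q p
  Tight-sym {p} {q} {r} (p≢q , q≢r , p≢r , eq) =
    q≢r ∘ sym , p≢q ∘ sym , p≢r ∘ sym , (begin
      dist r q ℕ.+ dist q p ≡⟨ cong₂ ℕ._+_ (dist-sym r q) (dist-sym q p) ⟩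
      dist q r ℕ.+ dist p q ≡⟨ ℕ.+-comm (dist q r) (dist p q) ⟩
      dist p q ℕ.+ dist q r ≡⟨ eq ⟩
      dist p r              ≡⟨ dist-sym p r ⟩
      dist r p              ∎)
    where open ≡-Reasoning

  cca-triangle : ∀ c c′ → m ℕ.+ height c ℕ.≤ gap c c′ ℕ.+ (m ℕ.+ height c′)
  cca-triangle c c′ = begin
    m ℕ.+ height c                 ≤⟨ ℕ.+-monoʳ-≤ m (height-triangle c c′) ⟩
    m ℕ.+ (gap c c′ ℕ.+ height c′) ≡⟨ x∙yz≈y∙xz m (gap c c′) (height c′) ⟩
    gap c c′ ℕ.+ (m ℕ.+ height c′) ∎
    where open ℕ.≤-Reasoning

  -- A detour through the axis costs at least 2m ≥ 4, while gaps are at most 2, so no axis point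
  -- lies between two corners.
  cac-triangle : ∀ c c′ → gap c c′ ℕ.< (m ℕ.+ height c) ℕ.+ (m ℕ.+ height c′)
  cac-triangle c c′ = begin-strict
    gap c c′  ≤⟨ gap≤2 c c′ ⟩
    2         ≤⟨ ℕ.m≤m+n 2 k ⟩
    m         ≤⟨ ℕ.m≤m+n m (height c) ⟩
    m ℕ.+ height c <⟨ ℕ.m<m+n (m ℕ.+ height c) ℕ.z<s ⟩
    (m ℕ.+ height c) ℕ.+ (m ℕ.+ height c′) ∎
    where open ℕ.≤-Reasoning

  -- The axis has diameter below m, so no corner lies between two axis points.
  aca-triangle : ∀ (i j : Fin m) c → ∣ toℕ i - toℕ j ∣ ℕ.< (m ℕ.+ height c) ℕ.+ (m ℕ.+ height c)
  aca-triangle i j c = begin-strict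
    ∣ toℕ i - toℕ j ∣  <⟨ ∣toℕ-toℕ∣<n i j ⟩
    m                  ≤⟨ ℕ.m≤m+n m (height c) ⟩
    m ℕ.+ height c     ≤⟨ ℕ.m≤m+n (m ℕ.+ height c) (m ℕ.+ height c) ⟩
    (m ℕ.+ height c) ℕ.+ (m ℕ.+ height c) ∎
    where open ℕ.≤-Reasoning

  dist-triangle : ∀ (p q r : Point m) → dist p r ℕ.≤ dist p q ℕ.+ dist q r
  dist-triangle (inj₁ c) (inj₁ c′) (inj₁ c″) = gap-triangle c c′ c″
  dist-triangle (inj₁ c) (inj₁ c′) (inj₂ i)  = cca-triangle c c′
  dist-triangle (inj₁ c) (inj₂ i)  (inj₁ c′) = ℕ.<⇒≤ (cac-triangle c c′)
  dist-triangle (inj₁ c) (inj₂ i)  (inj₂ j)  = ℕ.m≤m+n _ _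
  dist-triangle (inj₂ i) (inj₁ c)  (inj₁ c′) = subst (m ℕ.+ height c′ ℕ.≤_)
    (trans (cong (ℕ._+ (m ℕ.+ height c)) (gap-sym c′ c)) (ℕ.+-comm (gap c c′) _))
    (cca-triangle c′ c)
  dist-triangle (inj₂ i) (inj₁ c)  (inj₂ j)  = ℕ.<⇒≤ (aca-triangle i j c)
  dist-triangle (inj₂ i) (inj₂ j)  (inj₁ c)  = ℕ.m≤n+m _ _
  dist-triangle (inj₂ i) (inj₂ j)  (inj₂ l)  = ℕ.∣-∣-triangle (toℕ i) (toℕ j) (toℕ l)

  cca-tight : ∀ {c c′ i} → Tight (inj₁ c) (inj₁ c′) (inj₂ i) → c′ ≡ mate c
  cca-tight {c} {c′} (c≢c′ , _ , _ , eq) = height-tight c c′ (c≢c′ ∘ cong inj₁)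
    (ℕ.+-cancelˡ-≡ m _ _ (trans (x∙yz≈y∙xz m (gap c c′) (height c′)) eq))

  -- A corner is equidistant from all axis points, so equality would make i and j coincide.
  caa-not-tight : ∀ {c i j} → ¬ Tight (inj₁ c) (inj₂ i) (inj₂ j)
  caa-not-tight {c} {i} {j} (_ , i≢j , _ , eq) = contradiction
    (dist≡0⇒≡ (inj₂ i) (inj₂ j)
      (ℕ.+-cancelˡ-≡ (m ℕ.+ height c) _ _ (trans eq (sym (ℕ.+-identityʳ _)))))
    i≢j

  -- Of the eight patterns of corners and axis points, strict triangle inequalities exclude three
  -- and equidistance two more; what remains is the axis and the two orientations of a wing.
  Tight⇒Flat : ∀ {p q r} → Tight p q r → Flat p q r
  Tight⇒Flat {inj₁ c} {inj₁ c′} {inj₁ c″} (c≢c′ , c′≢c″ , _ , eq) = contradiction (sym eq)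
    (ℕ.<⇒≢ (gap-triangle-strict c c′ c″ (c≢c′ ∘ cong inj₁) (c′≢c″ ∘ cong inj₁)))
  Tight⇒Flat {inj₁ c} {inj₁ c′} {inj₂ i} tight with refl ← cca-tight tight = wing c i
  Tight⇒Flat {inj₁ c} {inj₂ i} {inj₁ c′} (_ , _ , _ , eq) =
    contradiction (sym eq) (ℕ.<⇒≢ (cac-triangle c c′))
  Tight⇒Flat {inj₁ c} {inj₂ i} {inj₂ j} tight = contradiction tight caa-not-tight
  Tight⇒Flat {inj₂ i} {inj₁ c} {inj₁ c′} tight with refl ← cca-tight (Tight-sym tight) = wing′ c′ i
  Tight⇒Flat {inj₂ i} {inj₁ c} {inj₂ j} (_ , _ , _ , eq) =
    contradiction (sym eq) (ℕ.<⇒≢ (aca-triangle i j c))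
  Tight⇒Flat {inj₂ i} {inj₂ j} {inj₁ c} tight = contradiction (Tight-sym tight) caa-not-tight
  Tight⇒Flat {inj₂ i} {inj₂ j} {inj₂ l} _ = axis i j l

  -- Sets closed under collinear triples

  Saturated : Pred (Point m) 0ℓ → Set
  Saturated P = ∀ {p q r} → Tight p q r → Majority (P p) (P q) (P r)

  module _ {P : Pred (Point m) 0ℓ} (sat : Saturated P) where

    -- Any third axis point forms a collinear triple with the two given ones, in one of three
    -- orders.
    axis-spread : ∀ {i j} → i ≢ j → P (inj₂ i) → P (inj₂ j) → ∀ l → P (inj₂ l)
    axis-spread {i} {j} i≢j Pi Pj l with i ≟ l | j ≟ l
    ... | yes refl | _        = Pi
    ... | no _     | yes refl = Pj
    ... | no i≢l   | no j≢l with ∣-∣-collinear (toℕ i) (toℕ j) (toℕ l)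
    ...   | inj₁ eq        =
      proj₁ (sat (inj₂-≢ i≢j , inj₂-≢ j≢l , inj₂-≢ i≢l , eq)) Pi Pj
    ...   | inj₂ (inj₁ eq) =
      proj₁ (sat (inj₂-≢ (i≢j ∘ sym) , inj₂-≢ i≢l , inj₂-≢ j≢l , eq)) Pj Pi
    ...   | inj₂ (inj₂ eq) =
      proj₂ (proj₂ (sat (inj₂-≢ i≢l , inj₂-≢ (j≢l ∘ sym) , inj₂-≢ i≢j , eq))) Pi Pj

    cca-majority : ∀ {c c′} → c ≢ c′ → gap c c′ ℕ.+ height c′ ≡ height c → ∀ i →
      Majority (P (inj₁ c)) (P (inj₁ c′)) (P (inj₂ i))
    cca-majority {c} {c′} c≢c′ eq i = sat
      ( c≢c′ ∘ inj₁-injective , (λ ()) , (λ ())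
      , trans (x∙yz≈y∙xz (gap c c′) m (height c′)) (cong (m ℕ.+_) eq))

    wing-majority : ∀ c i → Majority (P (inj₁ c)) (P (inj₁ (mate c))) (P (inj₂ i))
    wing-majority c i with mate-tight c
    ... | inj₁ eq = cca-majority (c≢mate c) eq i
    -- Here `mate c` lies behind c, so the triple is used with the corners swapped and the three
    -- implications are permuted back.
    ... | inj₂ eq =
      let (ca⇒ , ma⇒ , cm⇒) = cca-majority (c≢mate c ∘ sym) eq i
      in (λ Pc Pm → ca⇒ Pm Pc) , (λ Pm Pa → cm⇒ Pm Pa) , (λ Pc Pa → ma⇒ Pc Pa)

-- The seven closure-lines

Line : Set
Line = Fin 7

-- Each closure-line contains all of the axis or none of it, so its corners and the one Boolean
-- `hasAxis` describe it for every m.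
corners : Line → Subset 4
corners = lookup
  ( (outside ∷ outside ∷ outside ∷ outside ∷ [])
  ∷ (inside  ∷ inside  ∷ outside ∷ outside ∷ [])
  ∷ (outside ∷ outside ∷ inside  ∷ inside  ∷ [])
  ∷ (inside  ∷ outside ∷ inside  ∷ outside ∷ [])
  ∷ (inside  ∷ outside ∷ outside ∷ inside  ∷ [])
  ∷ (outside ∷ inside  ∷ inside  ∷ outside ∷ [])
  ∷ (outside ∷ inside  ∷ outside ∷ inside  ∷ [])
  ∷ [])

hasAxis : Line → Bool
hasAxis = lookup (inside ∷ inside ∷ inside ∷ outside ∷ outside ∷ outside ∷ outside ∷ [])

-- The diagonal entries of the table are junk.
joins : Corner → Corner → Line
joins c c′ = lookup (lookup table c) c′
  where
  table : Vec (Vec Line 4) 4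
  table = (# 0 ∷ # 1 ∷ # 3 ∷ # 4 ∷ [])
        ∷ (# 1 ∷ # 0 ∷ # 5 ∷ # 6 ∷ [])
        ∷ (# 3 ∷ # 5 ∷ # 0 ∷ # 2 ∷ [])
        ∷ (# 4 ∷ # 6 ∷ # 2 ∷ # 0 ∷ [])
        ∷ []

line : ∀ m → Line → Subset (4 ℕ.+ m)
line m t = corners t ++ replicate m (hasAxis t)

OnLine : ∀ {m} → Line → Pred (Point m) 0ℓ
OnLine t (inj₁ c) = lookup (corners t) c ≡ inside
OnLine t (inj₂ _) = hasAxis t ≡ inside

corner? : ∀ t c → Dec (lookup (corners t) c ≡ inside)
corner? t c = lookup (corners t) c Bool.≟ inside

hasAxis? : ∀ t → Dec (hasAxis t ≡ inside)
hasAxis? t = hasAxis t Bool.≟ inside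

corners-injective : ∀ t t′ → corners t ≡ corners t′ → t ≡ t′
corners-injective = from-yes (all? λ t → all? λ t′ →
  Vec.≡-dec Bool._≟_ (corners t) (corners t′) →-dec t ≟ t′)

line-injective : ∀ m {t t′} → line m t ≡ line m t′ → t ≡ t′
line-injective m {t} {t′} eq =
  corners-injective t t′ (Vec.++-injectiveˡ (corners t) (corners t′) eq)

-- Lines with the axis contain both or neither of two mates; lines without it contain at most one of
-- them.
wing-onLine : ∀ t c → Majority
  (lookup (corners t) c ≡ inside) (lookup (corners t) (mate c) ≡ inside) (hasAxis t ≡ inside)
wing-onLine = from-yes (all? λ t → all? λ c →
        (corner? t c →-dec corner? t (mate c) →-dec hasAxis? t)
  ×-dec (corner? t (mate c) →-dec hasAxis? t →-dec corner? t c)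
  ×-dec (corner? t c →-dec hasAxis? t →-dec corner? t (mate c)))

Flat⇒majority : ∀ {m} {p q r : Point m} t → Flat p q r →
  Majority (OnLine t p) (OnLine t q) (OnLine t r)
Flat⇒majority t (axis i j l) = (λ _ a → a) , (λ _ a → a) , (λ _ a → a)
Flat⇒majority t (wing c i)   = wing-onLine t c
Flat⇒majority t (wing′ c i)  =
  let (cm⇒ , ma⇒ , ca⇒) = wing-onLine t c
  in (λ Pa Pm → ma⇒ Pm Pa) , (λ Pm Pc → cm⇒ Pc Pm) , (λ Pa Pc → ca⇒ Pc Pa)

∣corners∣≤2 : ∀ t → Subset.∣ corners t ∣ ℕ.≤ 2
∣corners∣≤2 = from-yes (all? λ t → Subset.∣ corners t ∣ ℕ.≤? 2)

∣++∣ : ∀ {m n} (p : Subset m) (q : Subset n) →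
  Subset.∣ p ++ q ∣ ≡ Subset.∣ p ∣ ℕ.+ Subset.∣ q ∣
∣++∣ []            q = refl
∣++∣ (inside ∷ p)  q = cong suc (∣++∣ p q)
∣++∣ (outside ∷ p) q = ∣++∣ p q

joins-onLine : ∀ c c′ → c ≢ c′ →
  lookup (corners (joins c c′)) c ≡ inside × lookup (corners (joins c c′)) c′ ≡ inside
joins-onLine = from-yes (all? λ c → all? λ c′ → ¬? (c ≟ c′) →-dec
  (corner? (joins c c′) c ×-dec corner? (joins c c′) c′))

joins-hasAxis : ∀ c → hasAxis (joins c (mate c)) ≡ inside
joins-hasAxis = from-yes (all? λ c → hasAxis? (joins c (mate c)))

joins-corners : ∀ c c′ → c ≢ c′ → ∀ e → lookup (corners (joins c c′)) e ≡ inside → c ≡ e ⊎ c′ ≡ e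
joins-corners = from-yes (all? λ c → all? λ c′ → ¬? (c ≟ c′) →-dec (all? λ e →
  corner? (joins c c′) e →-dec ((c ≟ e) ⊎-dec (c′ ≟ e))))

joins-hasAxis⇒mate : ∀ c c′ → c ≢ c′ → hasAxis (joins c c′) ≡ inside → mate c ≡ c′
joins-hasAxis⇒mate = from-yes (all? λ c → all? λ c′ →
  ¬? (c ≟ c′) →-dec hasAxis? (joins c c′) →-dec (mate c ≟ c′))

-- A corner and an axis point force the mate of the corner, hence `joins c (mate c)` in the mixed
-- cases.
lineThrough : ∀ {m} → Point m → Point m → Line
lineThrough (inj₁ c) (inj₁ c′) = joins c c′
lineThrough (inj₁ c) (inj₂ _)  = joins c (mate c)
lineThrough (inj₂ _) (inj₁ c)  = joins c (mate c)
lineThrough (inj₂ _) (inj₂ _)  = # 0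

lineThrough-∋ : ∀ {m} (p q : Point m) → p ≢ q →
  OnLine (lineThrough p q) p × OnLine (lineThrough p q) q
lineThrough-∋ (inj₁ c) (inj₁ c′) c≢c′ = joins-onLine c c′ (c≢c′ ∘ cong inj₁)
lineThrough-∋ (inj₁ c) (inj₂ i)  _    = proj₁ (joins-onLine c (mate c) (c≢mate c)) , joins-hasAxis c
lineThrough-∋ (inj₂ i) (inj₁ c)  _    = joins-hasAxis c , proj₁ (joins-onLine c (mate c) (c≢mate c))
lineThrough-∋ (inj₂ i) (inj₂ j)  _    = refl , refl

-- Minimality of the seven lines

module _ {k} {P : Pred (Point (2 ℕ.+ k)) 0ℓ} (sat : Saturated P) where

  -- The line has no third corner, and it has axis points only when the two corners are mates; each
  -- axis point then completes a wing.
  corners⇒line : ∀ {c c′} → c ≢ c′ → P (inj₁ c) → P (inj₁ c′) → OnLine (joins c c′) ⊆ P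
  corners⇒line {c} {c′} c≢c′ Pc Pc′ {inj₁ e} e∈ with joins-corners c c′ c≢c′ e e∈
  ... | inj₁ refl = Pc
  ... | inj₂ refl = Pc′
  corners⇒line {c} {c′} c≢c′ Pc Pc′ {inj₂ i} axis∈ with joins-hasAxis⇒mate c c′ c≢c′ axis∈
  ... | refl = proj₁ (wing-majority sat c i) Pc Pc′

  wing⇒line : ∀ {c i} → P (inj₁ c) → P (inj₂ i) → OnLine (joins c (mate c)) ⊆ P
  wing⇒line {c} {i} Pc Pi =
    corners⇒line (c≢mate c) Pc (proj₂ (proj₂ (wing-majority sat c i)) Pc Pi)

  lineThrough⊆ : ∀ {p q} → p ≢ q → P p → P q → OnLine (lineThrough p q) ⊆ P
  lineThrough⊆ {inj₁ c} {inj₁ c′} c≢c′ Pc Pc′ = corners⇒line (c≢c′ ∘ cong inj₁) Pc Pc′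
  lineThrough⊆ {inj₁ c} {inj₂ i}  _    Pc Pi  = wing⇒line Pc Pi
  lineThrough⊆ {inj₂ i} {inj₁ c}  _    Pi Pc  = wing⇒line Pc Pi
  lineThrough⊆ {inj₂ i} {inj₂ j}  i≢j  Pi Pj {inj₁ e} e∈ =
    contradiction e∈ (from-yes (all? λ e → ¬? (corner? (# 0) e)) e)
  lineThrough⊆ {inj₂ i} {inj₂ j}  i≢j  Pi Pj {inj₂ l} _ =
    axis-spread sat (i≢j ∘ cong inj₂) Pi Pj l

ends : ∀ {k} → Line → Point (2 ℕ.+ k) × Point (2 ℕ.+ k)
ends zero    = inj₂ (# 0) , inj₂ (# 1)
ends (suc t) = lookup
  ( (inj₁ w , inj₁ x) ∷ (inj₁ y , inj₁ z) ∷ (inj₁ w , inj₁ y)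
  ∷ (inj₁ w , inj₁ z) ∷ (inj₁ x , inj₁ y) ∷ (inj₁ x , inj₁ z) ∷ []) t

-- Transfer to `Fin n` and the count of lines

module _ (k : ℕ) where

  private
    m = 2 ℕ.+ k
    n = 4 ℕ.+ m

  coord : Fin n → Point m
  coord = splitAt 4

  point : Point m → Fin n
  point = join 4 m

  coord-injective : ∀ {u v} → coord u ≡ coord v → u ≡ v
  coord-injective {u} {v} eq = begin
    u               ≡⟨ Fin.join-splitAt 4 m u ⟨
    point (coord u) ≡⟨ cong point eq ⟩
    point (coord v) ≡⟨ Fin.join-splitAt 4 m v ⟩
    v               ∎
    where open ≡-Reasoning

  space : MetricSpace (Fin n)
  space = record
    { ρ        = λ u v → fromℚ (fromℕ (dist (coord u) (coord v)))
    ; isMetric = record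
      { isSemiMetric = record
        { isQuasiSemiMetric = record
          { isPreMetric = record
            { isProtoMetric = record
              { isPartialOrder  = ≤-isPartialOrder
              ; ≈-isEquivalence = isEquivalence
              ; cong            = λ u≡u′ v≡v′ → fromℚ-cong
                  (cong₂ (λ u v → fromℕ (dist (coord u) (coord v))) u≡u′ v≡v′)
              ; nonNegative     = fromℚ-mono-≤ (fromℕ-mono-≤ ℕ.z≤n)
              }
            ; ≈⇒0 = λ { {u} refl → fromℚ-cong (cong fromℕ (dist-refl (coord u))) }
            }
          ; 0⇒≈ = λ {u} {v} eq → coord-injective
              (dist≡0⇒≡ (coord u) (coord v) (fromℕ-injective (fromℚ-injective eq)))
          }
        ; sym = λ u v → fromℚ-cong (cong fromℕ (dist-sym (coord u) (coord v)))
        }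
      ; triangle = λ u v t → fromℚ-mono-≤ (ℚ.≤-trans
          (fromℕ-mono-≤ (dist-triangle (coord u) (coord v) (coord t)))
          (ℚ.≤-reflexive (fromℕ-+ (dist (coord u) (coord v)) (dist (coord v) (coord t)))))
      }
    }

  Between⇒Tight : ∀ {u v t} → Between space u v t → Tight (coord u) (coord v) (coord t)
  Between⇒Tight {u} {v} {t} (u≢v , v≢t , u≢t , eq) =
      u≢v ∘ coord-injective , v≢t ∘ coord-injective , u≢t ∘ coord-injective
    , fromℕ-injective (trans
        (fromℕ-+ (dist (coord u) (coord v)) (dist (coord v) (coord t)))
        (fromℚ-injective eq))

  Tight⇒Between : ∀ {u v t} → Tight (coord u) (coord v) (coord t) → Between space u v t
  Tight⇒Between {u} {v} {t} (u≢v , v≢t , u≢t , eq) =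
      u≢v ∘ cong coord , v≢t ∘ cong coord , u≢t ∘ cong coord
    , fromℚ-cong (trans
        (sym (fromℕ-+ (dist (coord u) (coord v)) (dist (coord v) (coord t))))
        (cong fromℕ eq))

  OnLine-closed : ∀ t → AffinelyClosed (hypergraph space) (OnLine t ∘ coord)
  OnLine-closed t = majority⇒closed space (Flat⇒majority t ∘ Tight⇒Flat ∘ Between⇒Tight)

  closed⇒saturated : ∀ {T} → AffinelyClosed (hypergraph space) T → Saturated (T ∘ point)
  closed⇒saturated closed {p} {q} {r} tight = closed⇒majority space closed (Tight⇒Between
    -- `coord (point p)` equals p only propositionally, so tightness is transported in each of the
    -- three places.
    (subst₂ (λ p q → Tight p q (coord (point r)))
      (sym (Fin.splitAt-join 4 m p)) (sym (Fin.splitAt-join 4 m q))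
      (subst (Tight p q) (sym (Fin.splitAt-join 4 m r)) tight)))

  lookup-line : ∀ t v → lookup (line m t) v ≡ [ lookup (corners t) , const (hasAxis t) ]′ (coord v)
  lookup-line t v with splitAt 4 v | Vec.lookup-splitAt 4 (corners t) (replicate m (hasAxis t)) v
  ... | inj₁ c | eq = eq
  ... | inj₂ i | eq = trans eq (Vec.lookup-replicate i (hasAxis t))

  OnLine≐line : ∀ t → (OnLine t ∘ coord) ≐ (Subset._∈ line m t)
  OnLine≐line t = (λ {v} → to v) , λ {v} → from v
    where
    to : ∀ v → OnLine t (coord v) → v Subset.∈ line m t
    to v v∈ with coord v | lookup-line t v
    ... | inj₁ _ | eq = Vec.lookup⇒[]= v (line m t) (trans eq v∈)
    ... | inj₂ _ | eq = Vec.lookup⇒[]= v (line m t) (trans eq v∈)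
    from : ∀ v → v Subset.∈ line m t → OnLine t (coord v)
    from v v∈ with coord v | lookup-line t v
    ... | inj₁ _ | eq = trans (sym eq) (Vec.[]=⇒lookup v∈)
    ... | inj₂ _ | eq = trans (sym eq) (Vec.[]=⇒lookup v∈)

  -- The line is itself closed and contains u and v, so it bounds the closure from above. Conversely
  -- every closed set containing u and v is saturated in coordinates, and so contains the line.
  aff≐line : ∀ {u v} → u ≢ v →
    aff (hypergraph space) (｛ u ｝ ∪ ｛ v ｝) ≐ (Subset._∈ line m (lineThrough (coord u) (coord v)))
  aff≐line {u} {v} u≢v = ≐-trans (⊆line , line⊆) (OnLine≐line t)
    where
    t : Line
    t = lineThrough (coord u) (coord v)

    ⊆line : aff (hypergraph space) (｛ u ｝ ∪ ｛ v ｝) ⊆ (OnLine t ∘ coord)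
    ⊆line a∈ = a∈ (OnLine t ∘ coord) (OnLine-closed t)
      λ { (inj₁ refl) → proj₁ uv∈ ; (inj₂ refl) → proj₂ uv∈ }
      where
      uv∈ : OnLine t (coord u) × OnLine t (coord v)
      uv∈ = lineThrough-∋ (coord u) (coord v) (u≢v ∘ coord-injective)

    line⊆ : (OnLine t ∘ coord) ⊆ aff (hypergraph space) (｛ u ｝ ∪ ｛ v ｝)
    line⊆ {a} a∈ T closed uv⊆T = subst T (Fin.join-splitAt 4 m a)
      (lineThrough⊆ (closed⇒saturated closed) (u≢v ∘ coord-injective)
        (subst T (sym (Fin.join-splitAt 4 m u)) (uv⊆T (inj₁ refl)))
        (subst T (sym (Fin.join-splitAt 4 m v)) (uv⊆T (inj₂ refl)))
        {coord a} a∈)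

  -- Every line misses at least two of the four corners; `2 + m` is n - 2.
  ∣line∣≤ : ∀ t → Subset.∣ line m t ∣ ℕ.≤ 2 ℕ.+ m
  ∣line∣≤ t = begin
    Subset.∣ line m t ∣
      ≡⟨ ∣++∣ (corners t) (replicate m (hasAxis t)) ⟩
    Subset.∣ corners t ∣ ℕ.+ Subset.∣ replicate m (hasAxis t) ∣
      ≤⟨ ℕ.+-mono-≤ (∣corners∣≤2 t) (Subset.∣p∣≤n (replicate m (hasAxis t))) ⟩
    2 ℕ.+ m ∎
    where open ℕ.≤-Reasoning

  end₁ end₂ : Line → Fin n
  end₁ = point ∘ proj₁ ∘ ends
  end₂ = point ∘ proj₂ ∘ ends

  end₁≢end₂ : ∀ t → end₁ t ≢ end₂ t
  -- The check evaluates although k is a variable, because all the chosen ends are corners or one of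
  -- the first two axis points.
  end₁≢end₂ = from-yes (all? λ t → ¬? (end₁ t ≟ end₂ t))

  lineThrough-ends : ∀ t → lineThrough (coord (end₁ t)) (coord (end₂ t)) ≡ t
  lineThrough-ends = from-yes (all? λ t → lineThrough (coord (end₁ t)) (coord (end₂ t)) ≟ t)

  closureLine : Line → Pred (Fin n) _
  closureLine t = aff (hypergraph space) (｛ end₁ t ｝ ∪ ｛ end₂ t ｝)

  closureLine≐line : ∀ t → closureLine t ≐ (Subset._∈ line m t)
  closureLine≐line t = subst (λ t′ → closureLine t ≐ (Subset._∈ line m t′))
    (lineThrough-ends t) (aff≐line (end₁≢end₂ t))

  closureLine-injective : ∀ t t′ → closureLine t ≐ closureLine t′ → t ≡ t′
  closureLine-injective t t′ eq = line-injective m (Subset.⊆-antisym (proj₁ eq′) (proj₂ eq′))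
    where
    eq′ : (Subset._∈ line m t) ≐ (Subset._∈ line m t′)
    eq′ = ≐-trans (≐-sym (closureLine≐line t)) (≐-trans eq (closureLine≐line t′))

  closureLines : HasExactly 7 (IsClosureLine (hypergraph space))
  closureLines = closureLine
    , (λ t → end₁ t , end₂ t , end₁≢end₂ t , (λ v∈ → v∈) , λ v∈ → v∈)
    , closureLine-injective
    , λ { L (u , v , u≢v , L≐) → lineThrough (coord u) (coord v) ,
          ≐-trans L≐ (≐-trans (aff≐line u≢v) (≐-sym (closureLine≐line (lineThrough (coord u) (coord v))))) }

theorem7 : (n : ℕ) → n > 5 →
    Σ[ M ∈ MetricSpace (Fin n) ]
    (∀ L → IsClosureLine (hypergraph M) L → HasAtMost (n ∸ 2) L)
    × HasExactly 7 (IsClosureLine (hypergraph M))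
-- `n > 5` unfolds to `6 ≤ n`, so n is 6 + k: four corners and 2 + k axis points.
theorem7 n n>5 with k , refl ← ℕ.m≤n⇒∃[o]m+o≡n n>5 =
    space k
  , (λ { L (u , v , u≢v , L≐) →
         let t = lineThrough (coord k u) (coord k v)
         in line (2 ℕ.+ k) t , ≐-trans L≐ (aff≐line k u≢v) , ∣line∣≤ k t })
  , closureLines k
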